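{- For every integer $v\ge 3201$, we have $3v-5625\le m(v,2)\le 3v+25$, where $m(v,2)$ is the minimum number of edges of a $2$-e.c. graph on $v$ vertices.
   Context: All graphs are finite and simple. A graph $G$ is $n$-existentially closed ($n$-e.c.) if for all subsets $S\subseteq V(G)$ with $|S|=n$ and all partitions $S=A\sqcup B$ (with $A$ or $B$ possibly empty), there exists a vertex in $V(G)\setminus S$ adjacent to all vertices in $A$ and to no vertices in $B$. $m(v,n)$ denotes the minimum number of edges in an $n$-e.c. graph with $v$ vertices. -}

module Defs where

open import Data.Fin.Base using (Fin)
open import Data.Fin.Properties using (_<?_)
open import Data.Fin.Subset using (Subset; _∈_; _∉_; _∪_; _∩_; ∣_∣; Empty)
open import Data.List.Base using (List; length; filter; allFin; cartesianProduct)
open import Data.Nat.Base using (ℕ; _≤_)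
open import Data.Product.Base using (_×_; _,_; ∃-syntax)
open import Level using (0ℓ)
open import Relation.Binary.Core using (Rel)
open import Relation.Binary.Definitions using (Symmetric; Irreflexive; Decidable)
open import Relation.Binary.PropositionalEquality.Core using (_≡_)
open import Relation.Nullary.Decidable using (_×-dec_)
open import Relation.Nullary.Negation.Core using (¬_)

record Graph (v : ℕ) : Set₁ where
  field
    Adj    : Rel (Fin v) 0ℓ
    sym    : Symmetric Adj
    irrefl : Irreflexive _≡_ Adj
    adj?   : Decidable Adj

-- Each edge {i , j} is listed once, as the pair with i < j.
edges : ∀ {v} → Graph v → List (Fin v × Fin v)
edges {v} G =
  filter (λ (i , j) → (i <? j) ×-dec adj? i j)
         (cartesianProduct (allFin v) (allFin v))
  where open Graph G

∣E_∣ : ∀ {v} → Graph v → ℕ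
∣E G ∣ = length (edges G)

_PartitionedInto_⊔_ : ∀ {v} → Subset v → Subset v → Subset v → Set
S PartitionedInto A ⊔ B = (S ≡ A ∪ B) × Empty (A ∩ B)

ExistentiallyClosed : ∀ {v} → ℕ → Graph v → Set
ExistentiallyClosed {v} n G =
  ∀ (S A B : Subset v) → ∣ S ∣ ≡ n → S PartitionedInto A ⊔ B →
  ∃[ z ] z ∉ S
       × (∀ a → a ∈ A → Adj z a)
       × (∀ b → b ∈ B → ¬ Adj z b)
  where open Graph G

-- IsMinEdges v n k says that m(v,n) is defined and equal to k.  It is a
-- relation because an n-e.c. graph on v vertices need not exist.
IsMinEdges : ℕ → ℕ → ℕ → Set₁
IsMinEdges v n k =
    (∃[ G ] ExistentiallyClosed {v} n G × ∣E G ∣ ≡ k)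
  × (∀ (G : Graph v) → ExistentiallyClosed n G → k ≤ ∣E G ∣)

{-# OPTIONS --safe #-}
-- Lower bound, by discharging.  A vertex x₀ of degree at most 5 may be assumed to exist, and every vertex has a neighbour
-- in N(x₀).  All degrees are at least 4.  Give every vertex the charge 2 deg and let the vertices of a bounded set Q ⊇ N(x₀)
-- send 2 along each of their edges.  Outside Q only a vertex of degree 4 with a single neighbour a ∈ N(x₀) may fail to reach
-- 12.  If a non-neighbour of a has small degree, or a has few non-neighbours, then a bounded enlargement of Q supplies a
-- second donor.  Otherwise the non-neighbours of a are many and of large degree, and these or their neighbours can donate.
--
-- Upper bound.  Take three independent core vertices and a cycle whose vertices are each joined to two of them: a 2-e.c.
-- graph on 9, 10 or 11 vertices.  Adding a triangle whose i-th vertex is joined to the core vertices other than the i-th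
-- costs 9 edges for 3 vertices and preserves 2-existential closedness.
module Submission where

open import Data.Nat.Base using (ℕ; _+_; _*_; _∸_; _≤_; _≥_)
open import Data.Product.Base using (_×_; ∃-syntax)
open import Defs
open import Data.Bool.Base using (true; if_then_else_)
open import Data.Empty using (⊥)
open import Data.Fin.Base as Fin using (Fin; zero; suc; toℕ)
open import Data.Fin.Patterns using (0F; 1F; 2F)
import Data.Fin.Properties as Fin
open import Data.Fin.Subset as Subset using (Subset; inside; outside; ⁅_⁆; _∪_; ∣_∣)
open import Data.Fin.Subset.Properties using (anySubset?; ∣⁅x⁆∣≡1; ∪-identityˡ; ∪-identityʳ; ∉⊥; x∈⁅x⁆; x∈⁅y⁆⇒x≡y; x∈p∪q⁺; x∈p∪q⁻; x∈p∩q⁺; x∈p∩q⁻) renaming (_∈?_ to _∈ₛ?_)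
open import Data.List.Base using (List; []; _∷_; _++_; length; map; filter; allFin; cartesianProduct; concatMap)
import Data.List.Membership.DecPropositional as DecMembership
open import Data.List.Membership.Propositional using (_∈_; _∉_; find; lose)
open import Data.List.Membership.Propositional.Properties using (∈-++⁺ˡ; ∈-++⁺ʳ; ∈-++⁻; ∈-∃++; ∈-allFin; ∈-cartesianProduct⁺; ∈-concatMap⁺; ∈-filter⁺; ∈-filter⁻; ∈-map⁺)
open import Data.List.Properties using (filter-≐; length-++; length-map; length-tabulate; map-++; map-∘)
open import Data.List.Relation.Binary.Subset.Propositional using (_⊆_)
open import Data.List.Relation.Unary.All as All using (All; []; _∷_)
open import Data.List.Relation.Unary.All.Properties using (¬All⇒Any¬)
open import Data.List.Relation.Unary.AllPairs using ([]; _∷_)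
open import Data.List.Relation.Unary.Any using (here; there)
open import Data.List.Relation.Unary.Unique.Propositional using (Unique)
import Data.List.Relation.Unary.Unique.Propositional.Properties as Unique
open import Data.Nat.Base using (suc; _<_; z≤n)
open import Data.Nat.Induction using (<-rec)
open import Data.Nat.ListAction using (sum)
open import Data.Nat.ListAction.Properties using (sum-++)
open import Data.Nat.Properties
open import Data.Nat.Solver using (module +-*-Solver)
open +-*-Solver using (solve; _:+_; _:*_; _:=_; con)
open import Data.Product.Base using (_,_; proj₁; proj₂; uncurry)
open import Data.Sum.Base as Sum using (_⊎_; inj₁; inj₂)
open import Data.Vec.Base using (Vec; []; _∷_; here; there; lookup; tabulate)
open import Data.Vec.Properties using (lookup∘tabulate; []=⇒lookup; lookup⇒[]=)
open import Function.Base using (_∘_; const; id)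
open import Level using (Level; 0ℓ)
open import Relation.Binary.Core using (Rel)
open import Relation.Binary.Definitions as Binary using (tri<; tri≈; tri>)
open import Relation.Binary.PropositionalEquality.Core using (_≡_; _≢_; refl; sym; trans; cong; cong₂; subst; ≢-sym)
open import Relation.Nullary.Decidable using (Dec; yes; no; does; True; toWitness; from-yes; ¬?; _×-dec_; _⊎-dec_; _→-dec_; decidable-stable; dec-true)
open import Relation.Nullary.Negation.Core using (¬_; contradiction)
open import Relation.Unary using (Pred; Decidable)

private
  variable
    a b p r : Level
    A : Set a
    B : Set b
    P : Set p
    R : Set r
    k : ℕ

-- Finite sums over lists and counting.

∑ : List A → (A → ℕ) → ℕ
∑ xs f = sum (map f xs)

∑-mono-≤ : ∀ {f g : A → ℕ} xs → (∀ x → f x ≤ g x) → ∑ xs f ≤ ∑ xs g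
∑-mono-≤ []       f≤g = z≤n
∑-mono-≤ (x ∷ xs) f≤g = +-mono-≤ (f≤g x) (∑-mono-≤ xs f≤g)

∑-cong : ∀ {f g : A → ℕ} xs → (∀ x → f x ≡ g x) → ∑ xs f ≡ ∑ xs g
∑-cong []       f≡g = refl
∑-cong (x ∷ xs) f≡g = cong₂ _+_ (f≡g x) (∑-cong xs f≡g)

∑-const : ∀ (xs : List A) c → ∑ xs (const c) ≡ length xs * c
∑-const []       c = refl
∑-const (x ∷ xs) c = cong (c +_) (∑-const xs c)

∑-+ : ∀ (f g : A → ℕ) xs → ∑ xs (λ x → f x + g x) ≡ ∑ xs f + ∑ xs g
∑-+ f g []       = refl
∑-+ f g (x ∷ xs) = trans (cong (f x + g x +_) (∑-+ f g xs))
  (solve 4 (λ a b c d → (a :+ b) :+ (c :+ d) := (a :+ c) :+ (b :+ d)) refl (f x) (g x) (∑ xs f) (∑ xs g))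

∑-* : ∀ c (f : A → ℕ) xs → ∑ xs (λ x → c * f x) ≡ c * ∑ xs f
∑-* c f []       = sym (*-zeroʳ c)
∑-* c f (x ∷ xs) = trans (cong (c * f x +_) (∑-* c f xs)) (sym (*-distribˡ-+ c (f x) (∑ xs f)))

∑-swap : ∀ (f : A → B → ℕ) xs ys → ∑ xs (λ x → ∑ ys (f x)) ≡ ∑ ys (λ y → ∑ xs (λ x → f x y))
∑-swap f []       ys = sym (trans (∑-const ys 0) (*-zeroʳ (length ys)))
∑-swap f (x ∷ xs) ys = trans (cong (∑ ys (f x) +_) (∑-swap f xs ys)) (sym (∑-+ (f x) (λ y → ∑ xs (λ x → f x y)) ys))

∑-++ : ∀ (f : A → ℕ) xs ys → ∑ (xs ++ ys) f ≡ ∑ xs f + ∑ ys f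
∑-++ f xs ys = trans (cong sum (map-++ f xs ys)) (sum-++ (map f xs) (map f ys))

∑-cartesianProduct : ∀ (f : A × B → ℕ) xs ys →
  ∑ (cartesianProduct xs ys) f ≡ ∑ xs (λ x → ∑ ys (λ y → f (x , y)))
∑-cartesianProduct f []       ys = refl
∑-cartesianProduct f (x ∷ xs) ys = trans (∑-++ f (map (x ,_) ys) _)
  (cong₂ _+_ (cong sum (sym (map-∘ ys))) (∑-cartesianProduct f xs ys))

-- One occurrence of the head is cut out of `ys`. Uniqueness of `xs` keeps the tail inside what
-- remains, while `ys` may contain repetitions.
∑-⊆ : ∀ (f : A → ℕ) {xs ys} → Unique xs → xs ⊆ ys → ∑ xs f ≤ ∑ ys f
∑-⊆ f {[]}     []         xs⊆ys = z≤n
∑-⊆ f {x ∷ xs} (x∉xs ∷ u) xs⊆ys with ∈-∃++ (xs⊆ys (here refl))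
... | as , bs , refl = begin
  f x + ∑ xs f            ≤⟨ +-monoʳ-≤ (f x) (∑-⊆ f u xs⊆as++bs) ⟩
  f x + ∑ (as ++ bs) f    ≡⟨ cong (f x +_) (∑-++ f as bs) ⟩
  f x + (∑ as f + ∑ bs f) ≡⟨ solve 3 (λ a b c → a :+ (b :+ c) := b :+ (a :+ c)) refl (f x) (∑ as f) (∑ bs f) ⟩
  ∑ as f + (f x + ∑ bs f) ≡⟨ ∑-++ f as (x ∷ bs) ⟨
  ∑ (as ++ x ∷ bs) f      ∎
  where
  open ≤-Reasoning
  xs⊆as++bs : xs ⊆ as ++ bs
  xs⊆as++bs y∈xs with ∈-++⁻ as (xs⊆ys (there y∈xs))
  ... | inj₁ y∈as         = ∈-++⁺ˡ y∈as
  ... | inj₂ (here refl)  = contradiction refl (All.lookup x∉xs y∈xs)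
  ... | inj₂ (there y∈bs) = ∈-++⁺ʳ as y∈bs

length≡∑ : ∀ (xs : List A) → length xs ≡ ∑ xs (const 1)
length≡∑ xs = sym (trans (∑-const xs 1) (*-identityʳ (length xs)))

length-⊆ : ∀ {xs ys : List A} → Unique xs → xs ⊆ ys → length xs ≤ length ys
length-⊆ {xs = xs} {ys} u xs⊆ys rewrite length≡∑ xs | length≡∑ ys = ∑-⊆ (const 1) u xs⊆ys

length-concatMap : ∀ {c} (f : A → List B) → (∀ x → length (f x) ≤ c) → ∀ xs → length (concatMap f xs) ≤ length xs * c
length-concatMap f f≤c []       = z≤n
length-concatMap f f≤c (x ∷ xs) rewrite length-++ (f x) {concatMap f xs} = +-mono-≤ (f≤c x) (length-concatMap f f≤c xs)

⟦_⟧ : Dec P → ℕ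
⟦ P? ⟧ = if does P? then 1 else 0

∑-filter : ∀ {P : Pred A p} (P? : Decidable P) (f : A → ℕ) xs →
  ∑ (filter P? xs) f ≡ ∑ xs (λ x → if does (P? x) then f x else 0)
∑-filter P? f []       = refl
∑-filter P? f (x ∷ xs) with P? x
... | yes _ = cong (f x +_) (∑-filter P? f xs)
... | no  _ = ∑-filter P? f xs

length-filter≡∑ : ∀ {P : Pred A p} (P? : Decidable P) xs → length (filter P? xs) ≡ ∑ xs (λ x → ⟦ P? x ⟧)
length-filter≡∑ P? xs = trans (length≡∑ (filter P? xs)) (∑-filter P? (const 1) xs)

_∈?_ : ∀ {n} (x : Fin n) xs → Dec (x ∈ xs)
_∈?_ = DecMembership._∈?_ Fin._≟_

∃-∉ : ∀ {n} {xs ys : List (Fin n)} → Unique xs → length ys < length xs → ∃[ x ] x ∈ xs × x ∉ ys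
∃-∉ {xs = xs} {ys} u ys<xs with All.all? (_∈? ys) xs
... | yes xs⊆ys = contradiction (length-⊆ u (All.lookup xs⊆ys)) (<⇒≱ ys<xs)
... | no  xs⊈ys = find (¬All⇒Any¬ (_∈? ys) xs xs⊈ys)

-- Only one of the two mixed patterns is listed, since `PairwiseClosed` ranges over ordered pairs.
-- The inequalities omitted here follow from irreflexivity.
Resolved : {A : Set a} → (A → A → Set) → A → A → Set a
Resolved _~_ x y = (∃[ z ] z ~ x × z ~ y)
                 × (∃[ z ] z ≢ y × z ~ x × ¬ (z ~ y))
                 × (∃[ z ] z ≢ x × z ≢ y × ¬ (z ~ x) × ¬ (z ~ y))

PairwiseClosed : ∀ {v} → Graph v → Set
PairwiseClosed G = ∀ x y → x ≢ y → Resolved (Graph.Adj G) x y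

-- Neighbourhoods, edge lists and the handshake identity.

module _ {v} (G : Graph v) where
  open Graph G using (Adj; adj?) renaming (sym to Adj-sym; irrefl to Adj-irrefl)

  nbrs : Fin v → List (Fin v)
  nbrs x = filter (adj? x) (allFin v)

  deg : Fin v → ℕ
  deg x = length (nbrs x)

  ∈-nbrs⁺ : ∀ {x y} → Adj x y → y ∈ nbrs x
  ∈-nbrs⁺ {x} {y} xy = ∈-filter⁺ (adj? x) (∈-allFin y) xy

  private
    edge? : Decidable (λ ((x , y) : Fin v × Fin v) → x Fin.< y × Adj x y)
    edge? (x , y) = (x Fin.<? y) ×-dec adj? x y

  ∈-edges⁺ : ∀ {x y} → x Fin.< y → Adj x y → (x , y) ∈ edges G
  ∈-edges⁺ {x} {y} x<y xy = ∈-filter⁺ edge? (∈-cartesianProduct⁺ (∈-allFin x) (∈-allFin y)) (x<y , xy)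

  ∈-edges⁻ : ∀ {x y} → (x , y) ∈ edges G → x Fin.< y × Adj x y
  ∈-edges⁻ xy∈ = proj₂ (∈-filter⁻ edge? {xs = cartesianProduct (allFin v) (allFin v)} xy∈)

  edges-unique : Unique (edges G)
  edges-unique = Unique.filter⁺ edge? (Unique.cartesianProduct⁺ (Unique.allFin⁺ v) (Unique.allFin⁺ v))

  -- Exactly one orientation of an edge is increasing, so the indicator of adjacency is
  -- `edge x y + edge y x`. Both halves of the double sum equal the number of edges after a swap.
  handshake : ∑ (allFin v) deg ≡ 2 * ∣E G ∣
  handshake = begin-equality
    ∑ V deg                                                         ≡⟨ ∑-cong V (λ x → length-filter≡∑ (adj? x) V) ⟩
    ∑ V (λ x → ∑ V (λ y → ⟦ adj? x y ⟧))                            ≡⟨ ∑-cong V (λ x → trans (∑-cong V (orient x)) (∑-+ (edge x) (λ y → edge y x) V)) ⟩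
    ∑ V (λ x → ∑ V (edge x) + ∑ V (λ y → edge y x))                 ≡⟨ ∑-+ (λ x → ∑ V (edge x)) (λ x → ∑ V (λ y → edge y x)) V ⟩
    ∑ V (λ x → ∑ V (edge x)) + ∑ V (λ x → ∑ V (λ y → edge y x))     ≡⟨ cong (∑ V (λ x → ∑ V (edge x)) +_) (sym (∑-swap edge V V)) ⟩
    ∑ V (λ x → ∑ V (edge x)) + ∑ V (λ x → ∑ V (edge x))             ≡⟨ cong (λ e → e + e) (sym edges≡) ⟩
    ∣E G ∣ + ∣E G ∣                                                 ≡⟨ cong (∣E G ∣ +_) (sym (+-identityʳ ∣E G ∣)) ⟩
    2 * ∣E G ∣                                                      ∎
    where
    open ≤-Reasoning
    V = allFin v

    edge : Fin v → Fin v → ℕ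
    edge x y = ⟦ edge? (x , y) ⟧

    edges≡ : ∣E G ∣ ≡ ∑ V (λ x → ∑ V (edge x))
    edges≡ = trans (length-filter≡∑ edge? (cartesianProduct V V))
                   (∑-cartesianProduct (λ (x , y) → edge x y) V V)

    orientation : ∀ {x y} (p? : Dec (x Fin.< y)) (q? : Dec (y Fin.< x)) (r? : Dec (Adj x y)) (s? : Dec (Adj y x)) →
                  ⟦ r? ⟧ ≡ ⟦ p? ×-dec r? ⟧ + ⟦ q? ×-dec s? ⟧
    orientation (yes p) (yes q) _       _       = contradiction q (<-asym p)
    orientation (yes _) (no  _) (yes _) _       = refl
    orientation (yes _) (no  _) (no  _) _       = refl
    orientation (no  _) (yes _) (yes r) (no ¬s) = contradiction (Adj-sym r) ¬s
    orientation (no  _) (yes _) (yes _) (yes _) = refl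
    orientation (no  _) (yes _) (no ¬r) (yes s) = contradiction (Adj-sym s) ¬r
    orientation (no  _) (yes _) (no  _) (no  _) = refl
    orientation (no  _) (no  _) (no  _) _       = refl
    orientation {x} {y} (no ¬p) (no ¬q) (yes r) _ with Fin.<-cmp x y
    ... | tri< p _ _ = contradiction p ¬p
    ... | tri≈ _ e _ = contradiction r (Adj-irrefl e)
    ... | tri> _ _ q = contradiction q ¬q

    orient : ∀ x y → ⟦ adj? x y ⟧ ≡ edge x y + edge y x
    orient x y = orientation (x Fin.<? y) (y Fin.<? x) (adj? x y) (adj? y x)

-- Lower bound

-- The common shape of `rate` and `gift`. The lemmas below often assume `k ≤ 2`, so that passing the
-- first test never lowers the value.
tiered : Dec P → Dec R → ℕ → ℕ
tiered P? R? k = if does P? then 2 else if does R? then k else 0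

tiered-yes : (P? : Dec P) (R? : Dec R) → P → tiered P? R? k ≡ 2
tiered-yes (yes _) R? _ = refl
tiered-yes (no ¬p) R? p = contradiction p ¬p

≤-tiered : (P? : Dec P) (R? : Dec R) → k ≤ 2 → R → k ≤ tiered P? R? k
≤-tiered (yes _) R?      k≤2 _ = k≤2
≤-tiered (no  _) (yes _) _   _ = ≤-refl
≤-tiered (no  _) (no ¬r) _   r = contradiction r ¬r

tiered-≤2 : (P? : Dec P) (R? : Dec R) → k ≤ 2 → tiered P? R? k ≤ 2
tiered-≤2 (yes _) R?      _   = ≤-refl
tiered-≤2 (no  _) (yes _) k≤2 = k≤2
tiered-≤2 (no  _) (no  _) _   = z≤n

tiered-≤ : (P? : Dec P) (R? : Dec R) → ¬ P → tiered P? R? k ≤ k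
tiered-≤ (yes p) R?      ¬p = contradiction p ¬p
tiered-≤ (no  _) (yes _) _  = ≤-refl
tiered-≤ (no  _) (no  _) _  = z≤n

tiered-complement : (P? : Dec P) (R? : Dec R) → k ≤ 2 → ¬ P → tiered P? R? k + 2 * ⟦ ¬? R? ⟧ ≤ 2
tiered-complement (yes p) R?      _   ¬p = contradiction p ¬p
tiered-complement (no  _) (yes _) k≤2 _  = ≤-trans (≤-reflexive (+-identityʳ _)) k≤2
tiered-complement (no  _) (no  _) _   _  = ≤-refl

tiered-value : (P? : Dec P) (R? : Dec R) → P ⊎ (tiered P? R? k ≡ k × R) ⊎ tiered P? R? k ≡ 0
tiered-value (yes p) R?      = inj₁ p
tiered-value (no  _) (yes r) = inj₂ (inj₁ (refl , r))
tiered-value (no  _) (no  _) = inj₂ (inj₂ refl)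

-- Pairwise closedness is vacuous on a single vertex; `another` excludes this case and so provides
-- neighbours.
module LowerBound {v} (G : Graph v) (closed : PairwiseClosed G) (another : ∀ (x : Fin v) → ∃[ y ] x ≢ y) where
  open Graph G using (Adj; adj?) renaming (sym to Adj-sym; irrefl to Adj-irrefl)

  private
    V : List (Fin v)
    V = allFin v

    V-unique : Unique V
    V-unique = Unique.allFin⁺ v

    length-V : length V ≡ v
    length-V = length-tabulate id

    N : Fin v → List (Fin v)
    N = nbrs G

    d : Fin v → ℕ
    d = deg G

  Adj-≢ : ∀ {x y} → Adj x y → x ≢ y
  Adj-≢ xy x≡y = Adj-irrefl x≡y xy

  common : ∀ {x y} → x ≢ y → ∃[ z ] Adj x z × Adj y z
  common {x} {y} x≢y with closed x y x≢y
  ... | (z , zx , zy) , _ = z , Adj-sym zx , Adj-sym zy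

  private-nbr : ∀ {x y} → x ≢ y → ∃[ z ] z ≢ y × Adj x z × ¬ Adj y z
  private-nbr {x} {y} x≢y with closed x y x≢y
  ... | _ , (z , z≢y , zx , ¬zy) , _ = z , z≢y , Adj-sym zx , ¬zy ∘ Adj-sym

  nbr : ∀ x → ∃[ y ] Adj x y
  nbr x = let z , xz , _ = common (proj₂ (another x)) in z , xz

  length≤deg : ∀ {x zs} → Unique zs → All (Adj x) zs → length zs ≤ d x
  length≤deg u adj = length-⊆ u (∈-nbrs⁺ G ∘ All.lookup adj)

  -- Inside N(x) every vertex has both a neighbour and a non-neighbour, which is impossible on fewer than four vertices.
  4≤deg : ∀ x → 4 ≤ d x
  4≤deg x with nbr x
  ... | a , xa with common (Adj-≢ xa) | private-nbr (Adj-≢ xa)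
  ... | b , xb , ab | c , c≢a , xc , ¬ac with common (Adj-≢ xc) | private-nbr (Adj-≢ xb)
  ... | e , xe , ce | f , f≢b , xf , ¬bf with e Fin.≟ b
  ... | no  e≢b = length≤deg {zs = a ∷ b ∷ c ∷ e ∷ []}
    ((Adj-≢ ab ∷ ≢-sym c≢a ∷ (λ { refl → ¬ac (Adj-sym ce) }) ∷ []) ∷ ((λ { refl → ¬ac ab }) ∷ ≢-sym e≢b ∷ []) ∷ (Adj-≢ ce ∷ []) ∷ [] ∷ [])
    (xa ∷ xb ∷ xc ∷ xe ∷ [])
  -- Here `a` and `c` are both adjacent to `b`, so `f`, which is not, is the fourth neighbour.
  ... | yes refl = length≤deg {zs = a ∷ b ∷ c ∷ f ∷ []}
    ((Adj-≢ ab ∷ ≢-sym c≢a ∷ (λ { refl → ¬bf (Adj-sym ab) }) ∷ []) ∷ ((λ { refl → ¬ac ab }) ∷ ≢-sym f≢b ∷ []) ∷ ((λ { refl → ¬bf (Adj-sym ce) }) ∷ []) ∷ [] ∷ [])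
    (xa ∷ xb ∷ xc ∷ xf ∷ [])

  nonquartic : Fin v → List (Fin v)
  nonquartic u = filter (λ y → ¬? (d y ≟ 4)) (N u)

  nonnbrs : Fin v → List (Fin v)
  nonnbrs a = filter (λ w → ¬? (adj? w a)) V

  -- The threshold 10 makes every non-neighbour of `a` a donor of at least 1; 40 is the bound on the
  -- list `near` that a further non-neighbour has to avoid.
  SparselyAvoided : Fin v → Set
  SparselyAvoided a = (∀ w → ¬ Adj w a → 10 ≤ d w) × 40 < length (nonnbrs a)

  -- Produces the second donor of `u`. A non-neighbour `w` of `a` with small degree shares with `u`
  -- a neighbour, which lies in `N w` and differs from `a`. If `a` has few non-neighbours, they can
  -- all be listed, and `u` is adjacent to one of them.
  relay : ∀ a → ∃[ L ] length L ≤ 40 ×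
    (∀ {u} → u ∉ L → Adj u a → (∃[ b ] b ∈ L × a ≢ b × Adj b u) ⊎ SparselyAvoided a)
  relay a with Fin.any? (λ w → ¬? (adj? w a) ×-dec (d w <? 10))
  ... | yes (w , ¬wa , dw<10) = w ∷ N w , ≤-trans dw<10 (m≤n+m 10 30) , λ {u} u∉L ua →
    let b , wb , ub = common {w} {u} λ w≡u → u∉L (here (sym w≡u))
    in inj₁ (b , there (∈-nbrs⁺ G wb) , (λ { refl → ¬wa wb }) , Adj-sym ub)
  ... | no  none with length (nonnbrs a) ≤? 40
  ...   | yes few = nonnbrs a , few , λ ua∉ ua →
    let b , b≢a , ub , ¬ab = private-nbr (Adj-≢ ua)
    in inj₁ (b , ∈-filter⁺ (λ w → ¬? (adj? w a)) (∈-allFin b) (¬ab ∘ Adj-sym) , ≢-sym b≢a , Adj-sym ub)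
  ...   | no  many = [] , z≤n , λ _ _ → inj₂ ((λ w ¬wa → ≮⇒≥ λ dw<10 → none (w , ¬wa , dw<10)) , ≰⇒> many)

  module Discharging (x₀ : Fin v) (dx₀≤5 : d x₀ ≤ 5) where

    Q : List (Fin v)
    Q = N x₀ ++ concatMap (proj₁ ∘ relay) (N x₀)

    length-Q : length Q ≤ 205
    length-Q = begin
      length Q                       ≡⟨ length-++ (N x₀) ⟩
      d x₀ + length (concatMap _ (N x₀))
                                     ≤⟨ +-mono-≤ dx₀≤5 (length-concatMap (proj₁ ∘ relay) (proj₁ ∘ proj₂ ∘ relay) (N x₀)) ⟩
      5 + d x₀ * 40                  ≤⟨ +-monoʳ-≤ 5 (*-monoˡ-≤ 40 dx₀≤5) ⟩
      205                            ∎
      where open ≤-Reasoning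

    covered : ∀ u → ∃[ a ] a ∈ N x₀ × Adj u a
    covered u with u Fin.≟ x₀
    ... | yes refl = let a , ua = nbr u in a , ∈-nbrs⁺ G ua , ua
    ... | no  u≢x₀ = let a , ua , x₀a = common u≢x₀ in a , ∈-nbrs⁺ G x₀a , ua

    -- Both thresholds let a donor outside `Q` keep 10 of its charge: 2 for each of five neighbours
    -- that receive nothing, or 1 for each of ten edges. With the 2 that every vertex receives this
    -- makes 12.
    rate : Fin v → ℕ
    rate u = tiered (5 ≤? length (nonquartic u)) (10 ≤? d u) 1

    gift : Fin v → Fin v → ℕ
    gift u x = tiered (u ∈? Q) (d x ≟ 4) (rate u)

    -- Extended by 0 to non-adjacent pairs, so that total inflow and total outflow are the same
    -- double sum up to `∑-swap`.
    flow : Fin v → Fin v → ℕ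
    flow u x = if does (adj? u x) then gift u x else 0

    outflow inflow : Fin v → ℕ
    outflow u = ∑ V (flow u)
    inflow  u = ∑ V (λ z → flow z u)

    rate≤2 : ∀ u → rate u ≤ 2
    rate≤2 u = tiered-≤2 (5 ≤? length (nonquartic u)) (10 ≤? d u) (n≤1+n 1)

    gift-Q : ∀ {u} x → u ∈ Q → gift u x ≡ 2
    gift-Q {u} x = tiered-yes (u ∈? Q) (d x ≟ 4)

    rate≤gift : ∀ u {x} → d x ≡ 4 → rate u ≤ gift u x
    rate≤gift u {x} = ≤-tiered (u ∈? Q) (d x ≟ 4) (rate≤2 u)

    gift≤rate : ∀ {u} x → u ∉ Q → gift u x ≤ rate u
    gift≤rate {u} x = tiered-≤ (u ∈? Q) (d x ≟ 4)

    gift-nonquartic : ∀ {u} x → u ∉ Q → gift u x + 2 * ⟦ ¬? (d x ≟ 4) ⟧ ≤ 2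
    gift-nonquartic {u} x = tiered-complement (u ∈? Q) (d x ≟ 4) (rate≤2 u)

    2≤gift : ∀ {u x} → 5 ≤ length (nonquartic u) → d x ≡ 4 → 2 ≤ gift u x
    2≤gift {u} h dx≡4 = ≤-trans
      (≤-reflexive (sym (tiered-yes (5 ≤? length (nonquartic u)) (10 ≤? d u) h)))
      (rate≤gift u dx≡4)

    1≤gift : ∀ {u x} → 10 ≤ d u → d x ≡ 4 → 1 ≤ gift u x
    1≤gift {u} h dx≡4 = ≤-trans
      (≤-tiered (5 ≤? length (nonquartic u)) (10 ≤? d u) (n≤1+n 1) h)
      (rate≤gift u dx≡4)

    outflow≡ : ∀ u → outflow u ≡ ∑ (N u) (gift u)
    outflow≡ u = sym (∑-filter (adj? u) (gift u) V)

    outflow≤ : ∀ {u c} → (∀ x → gift u x ≤ c) → outflow u ≤ d u * c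
    outflow≤ {u} {c} g≤c = begin
      outflow u            ≡⟨ outflow≡ u ⟩
      ∑ (N u) (gift u)     ≤⟨ ∑-mono-≤ (N u) g≤c ⟩
      ∑ (N u) (const c)    ≡⟨ ∑-const (N u) c ⟩
      d u * c              ∎
      where open ≤-Reasoning

    ≤inflow : ∀ {u zs} → Unique zs → All (λ z → Adj z u) zs → ∑ zs (λ z → gift z u) ≤ inflow u
    ≤inflow {u} {zs} uniq adj = ≤-trans (≤-reflexive (gift≡flow adj)) (∑-⊆ (λ z → flow z u) uniq (λ _ → ∈-allFin _))
      where
      gift≡flow : ∀ {zs} → All (λ z → Adj z u) zs → ∑ zs (λ z → gift z u) ≡ ∑ zs (λ z → flow z u)
      gift≡flow []                     = refl
      gift≡flow {z ∷ zs} (zu ∷ adj) with adj? z u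
      ... | yes _  = cong (gift z u +_) (gift≡flow adj)
      ... | no ¬zu = contradiction zu ¬zu

    2≤inflow : ∀ u → 2 ≤ inflow u
    2≤inflow u =
      let a , a∈N , ua = covered u
      in ≤-trans (≤-reflexive (sym (trans (+-identityʳ _) (gift-Q u (∈-++⁺ˡ a∈N))))) (≤inflow ([] ∷ []) (Adj-sym ua ∷ []))

    relay⊆Q : ∀ {a b} → a ∈ N x₀ → b ∈ proj₁ (relay a) → b ∈ Q
    relay⊆Q a∈N b∈L = ∈-++⁺ʳ (N x₀) (∈-concatMap⁺ (proj₁ ∘ relay) (lose a∈N b∈L))

    -- Besides a, a non-neighbour w of a donates.  If w donates only 1, then at most 4 non-neighbours of a are adjacent to w,
    -- so some non-neighbour t of a shares with u a neighbour z of large degree other than w.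
    4≤inflow-sparse : ∀ {u a} → d u ≡ 4 → a ∈ N x₀ → Adj u a → SparselyAvoided a → 4 ≤ inflow u
    4≤inflow-sparse {u} {a} du≡4 a∈N ua (large , many) with private-nbr (Adj-≢ ua)
    ... | w , w≢a , uw , ¬aw with 5 ≤? length (nonquartic w)
    ... | yes h = ≤-trans
      (+-mono-≤ (≤-reflexive (sym (gift-Q u (∈-++⁺ˡ a∈N)))) (+-monoˡ-≤ 0 (2≤gift h du≡4)))
      (≤inflow ((≢-sym w≢a ∷ []) ∷ [] ∷ []) (Adj-sym ua ∷ Adj-sym uw ∷ []))
    -- The sum is 2 from `a`, 1 from `w` and 1 from `z`.
    ... | no ¬h = ≤-trans
      (+-mono-≤ (≤-reflexive (sym (gift-Q u (∈-++⁺ˡ a∈N))))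
        (+-mono-≤ (1≤gift (large w (¬aw ∘ Adj-sym)) du≡4)
          (+-monoˡ-≤ 0 (1≤gift 10≤dz du≡4))))
      (≤inflow ((≢-sym w≢a ∷ a≢z ∷ []) ∷ (w≢z ∷ []) ∷ [] ∷ []) (Adj-sym ua ∷ Adj-sym uw ∷ Adj-sym uz ∷ []))
      where
      smallN : Fin v → List (Fin v)
      smallN z = if does (10 ≤? d z) then [] else N z

      length-smallN : ∀ z → length (smallN z) ≤ 9
      length-smallN z = go (10 ≤? d z)
        where
        go : (h? : Dec (10 ≤ d z)) → length (if does h? then [] else N z) ≤ 9
        go (yes _) = z≤n
        go (no ¬h) = ≤-pred (≰⇒> ¬h)

      N⊆smallN : ∀ {z} → ¬ 10 ≤ d z → N z ⊆ smallN z
      N⊆smallN {z} ¬h {y} y∈ = go (10 ≤? d z)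
        where
        go : (h? : Dec (10 ≤ d z)) → y ∈ (if does h? then [] else N z)
        go (yes h) = contradiction h ¬h
        go (no  _) = y∈

      -- What `t` must avoid: at most 4 vertices, so that `t` is not adjacent to `w`, and at most 4
      -- times 9 vertices, so that no neighbour of `u` with degree below 10 is adjacent to `t`.
      near : List (Fin v)
      near = nonquartic w ++ concatMap smallN (N u)

      length-near : length near ≤ 40
      length-near = begin
        length near                                          ≡⟨ length-++ (nonquartic w) ⟩
        length (nonquartic w) + length (concatMap smallN (N u))
                                                             ≤⟨ +-mono-≤ (≤-pred (≰⇒> ¬h)) (length-concatMap smallN length-smallN (N u)) ⟩
        4 + d u * 9                                          ≡⟨ cong (λ k → 4 + k * 9) du≡4 ⟩
        40                                                   ∎
        where open ≤-Reasoning

      far : ∃[ t ] t ∈ nonnbrs a × t ∉ near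
      far = ∃-∉ (Unique.filter⁺ (λ w → ¬? (adj? w a)) V-unique) (≤-<-trans length-near many)

      t = proj₁ far

      ¬ta : ¬ Adj t a
      ¬ta = proj₂ (∈-filter⁻ (λ w → ¬? (adj? w a)) {xs = V} (proj₁ (proj₂ far)))

      link : ∃[ z ] Adj u z × Adj t z
      link = common λ u≡t → ¬ta (subst (λ y → Adj y a) u≡t ua)

      z = proj₁ link

      uz : Adj u z
      uz = proj₁ (proj₂ link)

      tz : Adj t z
      tz = proj₂ (proj₂ link)

      a≢z : a ≢ z
      a≢z a≡z = ¬ta (subst (Adj t) (sym a≡z) tz)

      w≢z : w ≢ z
      -- Being a non-neighbour of `a`, the vertex `t` has degree at least 10; adjacent to `w`, it
      -- would lie in `nonquartic w`.
      w≢z w≡z = proj₂ (proj₂ far) (∈-++⁺ˡ (∈-filter⁺ (λ y → ¬? (d y ≟ 4))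
        (∈-nbrs⁺ G (subst (λ y → Adj y t) (sym w≡z) (Adj-sym tz)))
        λ dt≡4 → contradiction (subst (10 ≤_) dt≡4 (large t ¬ta)) (<⇒≱ (m≤n+m 5 5))))

      10≤dz : 10 ≤ d z
      10≤dz = decidable-stable (10 ≤? d z) λ ¬h → proj₂ (proj₂ far)
        (∈-++⁺ʳ (nonquartic w) (∈-concatMap⁺ smallN (lose (∈-nbrs⁺ G uz) (N⊆smallN ¬h (∈-nbrs⁺ G (Adj-sym tz))))))

    4≤inflow : ∀ {u} → u ∉ Q → d u ≡ 4 → 4 ≤ inflow u
    4≤inflow {u} u∉Q du≡4 with covered u
    ... | a , a∈N , ua with proj₂ (proj₂ (relay a)) (u∉Q ∘ relay⊆Q a∈N) ua
    ...   | inj₁ (b , b∈L , a≢b , bu) = ≤-trans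
      (+-mono-≤ (≤-reflexive (sym (gift-Q u (∈-++⁺ˡ a∈N)))) (≤-reflexive (sym (trans (+-identityʳ _) (gift-Q u (relay⊆Q a∈N b∈L))))))
      (≤inflow ((a≢b ∷ []) ∷ [] ∷ []) (Adj-sym ua ∷ bu ∷ []))
    ...   | inj₂ sparse = 4≤inflow-sparse du≡4 a∈N ua sparse

    -- Outside `Q` only neighbours of degree 4 are paid, each at most 2, so every other neighbour
    -- saves 2.
    outflow-nonquartic : ∀ {u} → u ∉ Q → outflow u + 2 * length (nonquartic u) ≤ d u * 2
    outflow-nonquartic {u} u∉Q = begin
      outflow u + 2 * length (nonquartic u)        ≡⟨ cong₂ (λ x y → x + 2 * y) (outflow≡ u) (length-filter≡∑ (λ y → ¬? (d y ≟ 4)) (N u)) ⟩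
      ∑ (N u) (gift u) + 2 * ∑ (N u) nq            ≡⟨ cong (∑ (N u) (gift u) +_) (∑-* 2 nq (N u)) ⟨
      ∑ (N u) (gift u) + ∑ (N u) (λ y → 2 * nq y)  ≡⟨ ∑-+ (gift u) (λ y → 2 * nq y) (N u) ⟨
      ∑ (N u) (λ y → gift u y + 2 * nq y)          ≤⟨ ∑-mono-≤ (N u) (λ y → gift-nonquartic y u∉Q) ⟩
      ∑ (N u) (const 2)                            ≡⟨ ∑-const (N u) 2 ⟩
      d u * 2                                      ∎
      where
      open ≤-Reasoning
      nq : Fin v → ℕ
      nq y = ⟦ ¬? (d y ≟ 4) ⟧

    rate-value : ∀ u → 5 ≤ length (nonquartic u) ⊎ (rate u ≡ 1 × 10 ≤ d u) ⊎ rate u ≡ 0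
    rate-value u = tiered-value (5 ≤? length (nonquartic u)) (10 ≤? d u)

    balance-∉ : ∀ u → u ∉ Q → 12 + outflow u ≤ d u * 2 + inflow u
    balance-∉ u u∉Q with rate-value u
    ... | inj₁ h = begin
      12 + outflow u                                ≡⟨ solve 1 (λ o → con 12 :+ o := (o :+ con 2 :* con 5) :+ con 2) refl (outflow u) ⟩
      (outflow u + 2 * 5) + 2                       ≤⟨ +-mono-≤ (+-monoʳ-≤ (outflow u) (*-monoʳ-≤ 2 h)) (2≤inflow u) ⟩
      (outflow u + 2 * length (nonquartic u)) + inflow u
                                                    ≤⟨ +-monoˡ-≤ (inflow u) (outflow-nonquartic u∉Q) ⟩
      d u * 2 + inflow u                            ∎
      where open ≤-Reasoning
    ... | inj₂ (inj₁ (rate≡1 , 10≤d)) = begin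
      12 + outflow u          ≤⟨ +-monoʳ-≤ 12 (outflow≤ {c = 1} λ x → ≤-trans (gift≤rate x u∉Q) (≤-reflexive rate≡1)) ⟩
      12 + d u * 1            ≡⟨ solve 1 (λ d → con 12 :+ d :* con 1 := (con 10 :+ d) :+ con 2) refl (d u) ⟩
      (10 + d u) + 2          ≤⟨ +-mono-≤ (+-monoˡ-≤ (d u) 10≤d) (2≤inflow u) ⟩
      (d u + d u) + inflow u  ≡⟨ cong (_+ inflow u) (solve 1 (λ d → d :+ d := d :* con 2) refl (d u)) ⟩
      d u * 2 + inflow u      ∎
      where open ≤-Reasoning
    ... | inj₂ (inj₂ rate≡0) = begin
      12 + outflow u          ≤⟨ +-monoʳ-≤ 12 (outflow≤ {c = 0} λ x → ≤-trans (gift≤rate x u∉Q) (≤-reflexive rate≡0)) ⟩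
      12 + d u * 0            ≡⟨ cong (12 +_) (*-zeroʳ (d u)) ⟩
      12                      ≤⟨ enough (d u ≟ 4) ⟩
      d u * 2 + inflow u      ∎
      where
      open ≤-Reasoning
      enough : Dec (d u ≡ 4) → 12 ≤ d u * 2 + inflow u
      -- Degree 4 gives 8 + 4, any larger degree at least 10 + 2.
      enough (yes du≡4) = +-mono-≤ (*-monoˡ-≤ 2 (4≤deg u)) (4≤inflow u∉Q du≡4)
      enough (no  du≢4) = +-mono-≤ (*-monoˡ-≤ 2 (≤∧≢⇒< (4≤deg u) (≢-sym du≢4))) (2≤inflow u)

    -- A vertex of `Q` gives away its whole charge `2 deg`; its deficit of 12 is entered as an error
    -- term, bounded in total because `Q` is.
    balance : ∀ u → 12 + outflow u ≤ d u * 2 + inflow u + 12 * ⟦ u ∈? Q ⟧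
    balance u = go (u ∈? Q)
      where
      open ≤-Reasoning
      go : (u∈?Q : Dec (u ∈ Q)) → 12 + outflow u ≤ d u * 2 + inflow u + 12 * ⟦ u∈?Q ⟧
      go (no  u∉Q) = ≤-trans (balance-∉ u u∉Q) (m≤m+n _ 0)
      go (yes u∈Q) = begin
        12 + outflow u              ≤⟨ +-monoʳ-≤ 12 (outflow≤ λ x → ≤-reflexive (gift-Q x u∈Q)) ⟩
        12 + d u * 2                ≡⟨ +-comm 12 (d u * 2) ⟩
        d u * 2 + 12                ≤⟨ +-monoˡ-≤ 12 (m≤m+n (d u * 2) (inflow u)) ⟩
        d u * 2 + inflow u + 12     ∎

    ∑-inflow : ∑ V inflow ≡ ∑ V outflow
    ∑-inflow = sym (∑-swap flow V V)

    ∑-Q : ∑ V (λ u → ⟦ u ∈? Q ⟧) ≤ 205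
    ∑-Q = begin
      ∑ V (λ u → ⟦ u ∈? Q ⟧)      ≡⟨ length-filter≡∑ (_∈? Q) V ⟨
      length (filter (_∈? Q) V)   ≤⟨ length-⊆ (Unique.filter⁺ (_∈? Q) V-unique) (λ u∈ → proj₂ (∈-filter⁻ (_∈? Q) {xs = V} u∈)) ⟩
      length Q                    ≤⟨ length-Q ⟩
      205                         ∎
      where open ≤-Reasoning

    total : v * 12 + ∑ V outflow ≤ (4 * ∣E G ∣ + 12 * 205) + ∑ V outflow
    total = begin
      v * 12 + ∑ V outflow                        ≡⟨ cong (λ k → k * 12 + ∑ V outflow) length-V ⟨
      length V * 12 + ∑ V outflow                 ≡⟨ cong (_+ ∑ V outflow) (∑-const V 12) ⟨
      ∑ V (const 12) + ∑ V outflow                ≡⟨ ∑-+ (const 12) outflow V ⟨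
      ∑ V (λ u → 12 + outflow u)                  ≤⟨ ∑-mono-≤ V balance ⟩
      ∑ V (λ u → d u * 2 + inflow u + 12 * q u)   ≡⟨ ∑-+ (λ u → d u * 2 + inflow u) (λ u → 12 * q u) V ⟩
      ∑ V (λ u → d u * 2 + inflow u) + ∑ V (λ u → 12 * q u)
                                                  ≡⟨ cong₂ _+_ (∑-+ (λ u → d u * 2) inflow V) (∑-* 12 q V) ⟩
      ∑ V (λ u → d u * 2) + ∑ V inflow + 12 * ∑ V q
                                                  ≡⟨ cong (λ k → k + ∑ V inflow + 12 * ∑ V q) (trans (∑-cong V (λ u → *-comm (d u) 2)) (trans (∑-* 2 d V) (cong (2 *_) (handshake G)))) ⟩
      2 * (2 * ∣E G ∣) + ∑ V inflow + 12 * ∑ V q  ≤⟨ +-mono-≤ (+-monoʳ-≤ (2 * (2 * ∣E G ∣)) (≤-reflexive ∑-inflow)) (*-monoʳ-≤ 12 ∑-Q) ⟩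
      2 * (2 * ∣E G ∣) + ∑ V outflow + 12 * 205   ≡⟨ solve 2 (λ e o → con 2 :* (con 2 :* e) :+ o :+ con 2460 := con 4 :* e :+ con 2460 :+ o) refl ∣E G ∣ (∑ V outflow) ⟩
      (4 * ∣E G ∣ + 12 * 205) + ∑ V outflow       ∎
      where
      open ≤-Reasoning
      q : Fin v → ℕ
      q u = ⟦ u ∈? Q ⟧

    bound : 3 * v ≤ ∣E G ∣ + 615
    -- The initial charges sum to `4 * ∣E G ∣`, and the error 12 times 205 is 4 times 615.
    bound = *-cancelˡ-≤ 4 (begin
      4 * (3 * v)             ≡⟨ solve 1 (λ v → con 4 :* (con 3 :* v) := v :* con 12) refl v ⟩
      v * 12                  ≤⟨ +-cancelʳ-≤ (∑ V outflow) _ _ total ⟩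
      4 * ∣E G ∣ + 12 * 205   ≡⟨ *-distribˡ-+ 4 ∣E G ∣ 615 ⟨
      4 * (∣E G ∣ + 615)      ∎)
      where
      open ≤-Reasoning

  lower-bound : 3 * v ≤ ∣E G ∣ + 615
  lower-bound with Fin.any? (λ x → d x ≤? 5)
  ... | yes (x₀ , dx₀≤5) = Discharging.bound x₀ dx₀≤5
  -- All degrees are at least 6, so the handshake identity suffices.
  ... | no  none = *-cancelˡ-≤ 2 (begin
    2 * (3 * v)         ≡⟨ solve 1 (λ v → con 2 :* (con 3 :* v) := v :* con 6) refl v ⟩
    v * 6               ≡⟨ cong (_* 6) length-V ⟨
    length V * 6        ≡⟨ ∑-const V 6 ⟨
    ∑ V (const 6)       ≤⟨ ∑-mono-≤ V (λ x → ≰⇒> λ d≤5 → none (x , d≤5)) ⟩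
    ∑ V d               ≡⟨ handshake G ⟩
    2 * ∣E G ∣          ≤⟨ *-monoʳ-≤ 2 (m≤m+n ∣E G ∣ 615) ⟩
    2 * (∣E G ∣ + 615)  ∎)
    where
    open ≤-Reasoning

-- The minimum exists

∣p∣≡0⇒∉ : ∀ {n} (p : Subset n) → ∣ p ∣ ≡ 0 → ∀ {x} → x Subset.∉ p
∣p∣≡0⇒∉ (outside ∷ p) eq (there x∈p) = ∣p∣≡0⇒∉ p eq x∈p

∣p∣≡1⇒singleton : ∀ {n} (p : Subset n) → ∣ p ∣ ≡ 1 → ∃[ x ] x Subset.∈ p × (∀ {z} → z Subset.∈ p → z ≡ x)
∣p∣≡1⇒singleton (inside ∷ p) eq = zero , here , λ
  { here        → refl
  ; (there z∈p) → contradiction z∈p (∣p∣≡0⇒∉ p (suc-injective eq)) }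
∣p∣≡1⇒singleton (outside ∷ p) eq =
  let x , x∈p , only = ∣p∣≡1⇒singleton p eq
  in suc x , there x∈p , λ { (there z∈p) → cong suc (only z∈p) }

∣p∣≡2⇒pair : ∀ {n} (p : Subset n) → ∣ p ∣ ≡ 2 →
  ∃[ x ] ∃[ y ] x ≢ y × x Subset.∈ p × y Subset.∈ p × (∀ {z} → z Subset.∈ p → z ≡ x ⊎ z ≡ y)
∣p∣≡2⇒pair (inside ∷ p) eq =
  let y , y∈p , only = ∣p∣≡1⇒singleton p (suc-injective eq)
  in zero , suc y , (λ ()) , here , there y∈p , λ
    { here        → inj₁ refl
    ; (there z∈p) → inj₂ (cong suc (only z∈p)) }
∣p∣≡2⇒pair (outside ∷ p) eq =
  let x , y , x≢y , x∈p , y∈p , only = ∣p∣≡2⇒pair p eq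
  in suc x , suc y , x≢y ∘ Fin.suc-injective , there x∈p , there y∈p , λ
    { (there z∈p) → Sum.map (cong suc) (cong suc) (only z∈p) }

∣⁅x⁆∪⁅y⁆∣≡2 : ∀ {n} (x y : Fin n) → x ≢ y → ∣ ⁅ x ⁆ ∪ ⁅ y ⁆ ∣ ≡ 2
∣⁅x⁆∪⁅y⁆∣≡2 zero    zero    x≢y = contradiction refl x≢y
∣⁅x⁆∪⁅y⁆∣≡2 zero    (suc y) x≢y = cong suc (trans (cong ∣_∣ (∪-identityˡ ⁅ y ⁆)) (∣⁅x⁆∣≡1 y))
∣⁅x⁆∪⁅y⁆∣≡2 (suc x) zero    x≢y = cong suc (trans (cong ∣_∣ (∪-identityʳ ⁅ x ⁆)) (∣⁅x⁆∣≡1 x))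
∣⁅x⁆∪⁅y⁆∣≡2 (suc x) (suc y) x≢y = ∣⁅x⁆∪⁅y⁆∣≡2 x y (x≢y ∘ cong suc)

module _ {v} (G : Graph v) where
  open Graph G using (Adj; adj?) renaming (irrefl to Adj-irrefl)

  -- The clauses come from the partitions of the pair with `B` empty, with `x` and `y` separated,
  -- and with `A` empty.
  closed⇒pairwise : ExistentiallyClosed 2 G → PairwiseClosed G
  closed⇒pairwise closed x y x≢y
    with closed S S Subset.⊥ ∣S∣≡2 (sym (∪-identityʳ S) , λ (_ , w∈) → ∉⊥ (proj₂ (x∈p∩q⁻ S Subset.⊥ w∈)))
       | closed S ⁅ x ⁆ ⁅ y ⁆ ∣S∣≡2 (refl , λ (_ , w∈) → let w∈x , w∈y = x∈p∩q⁻ ⁅ x ⁆ ⁅ y ⁆ w∈ in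
                                     x≢y (trans (sym (x∈⁅y⁆⇒x≡y x w∈x)) (x∈⁅y⁆⇒x≡y y w∈y)))
       | closed S Subset.⊥ S ∣S∣≡2 (sym (∪-identityˡ S) , λ (_ , w∈) → ∉⊥ (proj₁ (x∈p∩q⁻ Subset.⊥ S w∈)))
    where
    S = ⁅ x ⁆ ∪ ⁅ y ⁆
    ∣S∣≡2 = ∣⁅x⁆∪⁅y⁆∣≡2 x y x≢y
  ... | z₁ , _ , adj₁ , _ | z₂ , z₂∉S , adj₂ , ¬adj₂ | z₃ , z₃∉S , _ , ¬adj₃ =
      (z₁ , adj₁ x x∈S , adj₁ y y∈S)
    , (z₂ , ∉S⇒≢y z₂∉S , adj₂ x (x∈⁅x⁆ x) , ¬adj₂ y (x∈⁅x⁆ y))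
    , (z₃ , (λ { refl → z₃∉S x∈S }) , ∉S⇒≢y z₃∉S , ¬adj₃ x x∈S , ¬adj₃ y y∈S)
    where
    x∈S : x Subset.∈ ⁅ x ⁆ ∪ ⁅ y ⁆
    x∈S = x∈p∪q⁺ (inj₁ (x∈⁅x⁆ x))
    y∈S : y Subset.∈ ⁅ x ⁆ ∪ ⁅ y ⁆
    y∈S = x∈p∪q⁺ {p = ⁅ x ⁆} (inj₂ (x∈⁅x⁆ y))
    ∉S⇒≢y : ∀ {z} → z Subset.∉ ⁅ x ⁆ ∪ ⁅ y ⁆ → z ≢ y
    ∉S⇒≢y z∉S refl = z∉S y∈S

  pairwise⇒closed : PairwiseClosed G → ExistentiallyClosed 2 G
  pairwise⇒closed pairwise S A B ∣S∣≡2 (refl , disjoint) with ∣p∣≡2⇒pair S ∣S∣≡2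
  ... | x , y , x≢y , x∈S , y∈S , only = answer (x∈p∪q⁻ A B x∈S) (x∈p∪q⁻ A B y∈S)
    where
    -- Storing the side of `w` next to the adjacency lets the disjointness of `A` and `B` discard
    -- the wrong alternative in `on-A` and `on-B`.
    Respects : Fin v → Fin v → Set
    Respects z w = w Subset.∈ A × Adj z w ⊎ w Subset.∈ B × ¬ Adj z w

    separates : ∀ {z} → z ≢ x → z ≢ y → Respects z x → Respects z y →
      ∃[ z ] z Subset.∉ S × (∀ a → a Subset.∈ A → Adj z a) × (∀ b → b Subset.∈ B → ¬ Adj z b)
    separates {z} z≢x z≢y rx ry = z , (λ z∈S → Sum.[ z≢x , z≢y ] (only z∈S)) , on-A , on-B
      where
      respects : ∀ {w} → w Subset.∈ S → Respects z w
      respects w∈S with only w∈S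
      ... | inj₁ refl = rx
      ... | inj₂ refl = ry
      on-A : ∀ a → a Subset.∈ A → Adj z a
      on-A a a∈A with respects (x∈p∪q⁺ (inj₁ a∈A))
      ... | inj₁ (_ , za)  = za
      ... | inj₂ (a∈B , _) = contradiction (a , x∈p∩q⁺ (a∈A , a∈B)) disjoint
      on-B : ∀ b → b Subset.∈ B → ¬ Adj z b
      on-B b b∈B with respects (x∈p∪q⁺ {p = A} (inj₂ b∈B))
      ... | inj₁ (b∈A , _) = contradiction (b , x∈p∩q⁺ (b∈A , b∈B)) disjoint
      ... | inj₂ (_ , ¬zb) = ¬zb

    ≢-of : ∀ {z w} → Adj z w → z ≢ w
    ≢-of zw z≡w = Adj-irrefl z≡w zw

    answer : x Subset.∈ A ⊎ x Subset.∈ B → y Subset.∈ A ⊎ y Subset.∈ B → _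
    answer (inj₁ x∈A) (inj₁ y∈A) =
      let (z , zx , zy) , _ = pairwise x y x≢y
      in separates (≢-of zx) (≢-of zy) (inj₁ (x∈A , zx)) (inj₁ (y∈A , zy))
    answer (inj₁ x∈A) (inj₂ y∈B) =
      let _ , (z , z≢y , zx , ¬zy) , _ = pairwise x y x≢y
      in separates (≢-of zx) z≢y (inj₁ (x∈A , zx)) (inj₂ (y∈B , ¬zy))
    -- The missing mixed pattern is read off the reversed pair.
    answer (inj₂ x∈B) (inj₁ y∈A) =
      let _ , (z , z≢x , zy , ¬zx) , _ = pairwise y x (≢-sym x≢y)
      in separates z≢x (≢-of zy) (inj₂ (x∈B , ¬zx)) (inj₁ (y∈A , zy))
    answer (inj₂ x∈B) (inj₂ y∈B) =
      let _ , _ , (z , z≢x , z≢y , ¬zx , ¬zy) = pairwise x y x≢y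
      in separates z≢x z≢y (inj₂ (x∈B , ¬zx)) (inj₂ (y∈B , ¬zy))

  pairwise? : Dec (PairwiseClosed G)
  pairwise? = Fin.all? λ x → Fin.all? λ y → ¬? (x Fin.≟ y) →-dec
    ( Fin.any? (λ z → adj? z x ×-dec adj? z y)
    ×-dec Fin.any? (λ z → ¬? (z Fin.≟ y) ×-dec adj? z x ×-dec ¬? (adj? z y))
    ×-dec Fin.any? (λ z → ¬? (z Fin.≟ x) ×-dec ¬? (z Fin.≟ y) ×-dec ¬? (adj? z x) ×-dec ¬? (adj? z y)))

-- Coding graphs by finite subsets, and the search for the minimum.

symmetrised : ∀ {v} {R : Rel (Fin v) 0ℓ} → Binary.Decidable R → Graph v
symmetrised {R = R} R? = record
  { Adj    = λ x y → x ≢ y × (R x y ⊎ R y x)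
  ; sym    = λ (x≢y , r) → ≢-sym x≢y , Sum.swap r
  ; irrefl = λ x≡y (x≢y , _) → x≢y x≡y
  ; adj?   = λ x y → ¬? (x Fin.≟ y) ×-dec (R? x y ⊎-dec R? y x)
  }

_≋_ : ∀ {v} → Graph v → Graph v → Set
G ≋ H = ∀ {x y} → (Graph.Adj G x y → Graph.Adj H x y) × (Graph.Adj H x y → Graph.Adj G x y)

∣E∣-cong : ∀ {v} {G H : Graph v} → G ≋ H → ∣E G ∣ ≡ ∣E H ∣
∣E∣-cong {v} {G} {H} G≋H = cong length (filter-≐ _ _
  ((λ (lt , a) → lt , proj₁ G≋H a) , (λ (lt , a) → lt , proj₂ G≋H a)) (cartesianProduct (allFin v) (allFin v)))

PairwiseClosed-cong : ∀ {v} {G H : Graph v} → G ≋ H → PairwiseClosed G → PairwiseClosed H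
PairwiseClosed-cong G≋H closed x y x≢y with closed x y x≢y
... | (z₁ , zx₁ , zy₁) , (z₂ , z≢y₂ , zx₂ , ¬zy₂) , (z₃ , z≢x₃ , z≢y₃ , ¬zx₃ , ¬zy₃) =
    (z₁ , proj₁ G≋H zx₁ , proj₁ G≋H zy₁)
  , (z₂ , z≢y₂ , proj₁ G≋H zx₂ , ¬zy₂ ∘ proj₂ G≋H)
  , (z₃ , z≢x₃ , z≢y₃ , ¬zx₃ ∘ proj₂ G≋H , ¬zy₃ ∘ proj₂ G≋H)

-- Graphs carry `Set`-valued relations and cannot be enumerated, but subsets of the set of pairs
-- can. Symmetrising makes every subset the code of a graph.
decode : ∀ {v} → Subset (v * v) → Graph v
decode s = symmetrised (λ x y → Fin.combine x y ∈ₛ? s)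

encode : ∀ {v} → Graph v → Subset (v * v)
encode {v} G = tabulate (does ∘ uncurry (Graph.adj? G) ∘ Fin.remQuot {v} v)

decode-encode : ∀ {v} (G : Graph v) → G ≋ decode (encode G)
decode-encode {v} G {x} {y} = (λ xy → (λ x≡y → Adj-irrefl x≡y xy) , inj₁ (to x y xy)) , λ (_ , r) → Sum.[ from x y , Adj-sym ∘ from y x ] r
  where
  open Graph G using (Adj; adj?) renaming (sym to Adj-sym; irrefl to Adj-irrefl)

  lookup-encode : ∀ x y → lookup (encode G) (Fin.combine x y) ≡ does (adj? x y)
  lookup-encode x y = trans (lookup∘tabulate _ (Fin.combine x y)) (cong (does ∘ uncurry adj?) (Fin.remQuot-combine x y))

  to : ∀ x y → Adj x y → Fin.combine x y Subset.∈ encode G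
  to x y xy = lookup⇒[]= _ _ (trans (lookup-encode x y) (dec-true (adj? x y) xy))

  from : ∀ x y → Fin.combine x y Subset.∈ encode G → Adj x y
  from x y ∈G = does⇒ (adj? x y) (trans (sym (lookup-encode x y)) ([]=⇒lookup ∈G))
    where
    does⇒ : ∀ {P : Set} (P? : Dec P) → does P? ≡ true → P
    does⇒ (yes p) _ = p

least : ∀ {P : Pred ℕ 0ℓ} → Decidable P → ∀ n → P n → ∃[ m ] P m × (∀ {k} → P k → m ≤ k)
least {P} P? = <-rec _ λ n smaller Pn → go n smaller Pn (anyUpTo? P? n)
  where
  go : ∀ n → (∀ {k} → k < n → P k → _) → P n → Dec (∃[ k ] k < n × P k) → ∃[ m ] P m × (∀ {k} → P k → m ≤ k)
  go n smaller Pn (yes (k , k<n , Pk)) = smaller k<n Pk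
  go n smaller Pn (no  none)           = n , Pn , λ Pk → ≮⇒≥ λ k<n → none (_ , k<n , Pk)

-- Whether an edge number is attained is decided by searching all codes. `G` shows that some number
-- is attained, and any competitor has as many edges as the graph decoded from its code.
minEdges : ∀ {v} (G : Graph v) → PairwiseClosed G → ∃[ m ] IsMinEdges v 2 m
minEdges {v} G closed =
  let m , (s , s-closed , s-edges) , minimal = least attained? ∣E G ∣ (attained G closed)
  in m , (decode s , pairwise⇒closed (decode s) s-closed , s-edges)
       , λ H H-closed → minimal (attained H (closed⇒pairwise H H-closed))
  where
  Attained : Pred ℕ 0ℓ
  Attained k = ∃[ s ] PairwiseClosed (decode {v} s) × ∣E decode {v} s ∣ ≡ k

  attained? : Decidable Attained
  attained? k = anySubset? λ s → pairwise? (decode {v} s) ×-dec (∣E decode {v} s ∣ ≟ k)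

  attained : ∀ (H : Graph v) → PairwiseClosed H → Attained ∣E H ∣
  attained H closed = encode H
    , PairwiseClosed-cong {G = H} {decode (encode H)} (decode-encode H) closed
    , sym (∣E∣-cong {G = H} {decode (encode H)} (decode-encode H))

-- Upper bound

-- The patterns "both" and "neither" are symmetric, so four witnesses serve both orders.
resolved-both : ∀ (_~_ : A → A → Set) {x y} →
  (∃[ z ] z ~ x × z ~ y) →
  (∃[ z ] z ≢ y × z ~ x × ¬ (z ~ y)) →
  (∃[ z ] z ≢ x × z ~ y × ¬ (z ~ x)) →
  (∃[ z ] z ≢ x × z ≢ y × ¬ (z ~ x) × ¬ (z ~ y)) →
  Resolved _~_ x y × Resolved _~_ y x
resolved-both _ (z , zx , zy) left right (w , w≢x , w≢y , ¬wx , ¬wy) =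
    ((z , zx , zy) , left  , (w , w≢x , w≢y , ¬wx , ¬wy))
  , ((z , zy , zx) , right , (w , w≢y , w≢x , ¬wy , ¬wx))

-- Witnesses are pulled back along the section `g`. With `splitAt` and `join` this allows the work
-- to be done on a disjoint sum.
resolved-via : ∀ (_~_ : B → B → Set) (f : A → B) (g : B → A) → (∀ y → f (g y) ≡ y) →
  ∀ {x y} → Resolved _~_ (f x) (f y) → Resolved (λ x y → f x ~ f y) x y
resolved-via _~_ f g fg ((z₁ , zx₁ , zy₁) , (z₂ , z≢y₂ , zx₂ , ¬zy₂) , (z₃ , z≢x₃ , z≢y₃ , ¬zx₃ , ¬zy₃)) =
    (g z₁ , back zx₁ , back zy₁)
  , (g z₂ , distinct z≢y₂ , back zx₂ , ¬zy₂ ∘ forth)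
  , (g z₃ , distinct z≢x₃ , distinct z≢y₃ , ¬zx₃ ∘ forth , ¬zy₃ ∘ forth)
  where
  back : ∀ {z w} → z ~ w → f (g z) ~ w
  back {z} {w} = subst (_~ w) (sym (fg z))
  forth : ∀ {z w} → f (g z) ~ w → z ~ w
  forth {z} {w} = subst (_~ w) (fg z)
  distinct : ∀ {z w} → z ≢ f w → g z ≢ w
  distinct {z} z≢fw gz≡w = z≢fw (trans (sym (fg z)) (cong f gz≡w))

-- The invariant of the construction. By `attached`, every vertex off the core is joined to at least
-- two core vertices.
record Anchored (n : ℕ) : Set₁ where
  field
    graph : Graph n
    core  : Fin 3 → Fin n
  open Graph graph public using (Adj; adj?) renaming (sym to Adj-sym; irrefl to Adj-irrefl)

  Outer : Fin n → Set
  Outer u = ∀ j → core j ≢ u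

  field
    core-injective : ∀ {i j} → core i ≡ core j → i ≡ j
    independent    : ∀ i j → ¬ Adj (core i) (core j)
    attached       : ∀ u → Outer u → ∃[ m ] ∀ j → j ≢ m → Adj u (core j)
    pairwise       : PairwiseClosed graph
    ∣E∣≤3n         : ∣E graph ∣ ≤ 3 * n

avoid : ∀ (i j : Fin 3) → ∃[ k ] k ≢ i × k ≢ j
avoid = from-yes (Fin.all? {n = 3} λ i → Fin.all? {n = 3} λ j → Fin.any? {n = 3} λ k → ¬? (k Fin.≟ i) ×-dec ¬? (k Fin.≟ j))

-- Attaching a triangle to the core.

module Extension {n} (K : Anchored n) where
  open Anchored K

  _~_ : Fin 3 ⊎ Fin n → Fin 3 ⊎ Fin n → Set
  inj₁ i ~ inj₁ j = i ≢ j
  inj₁ i ~ inj₂ u = ∃[ j ] j ≢ i × core j ≡ u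
  inj₂ u ~ inj₁ i = ∃[ j ] j ≢ i × core j ≡ u
  inj₂ u ~ inj₂ w = Adj u w

  ~-sym : ∀ x y → x ~ y → y ~ x
  ~-sym (inj₁ _) (inj₁ _) = ≢-sym
  ~-sym (inj₁ _) (inj₂ _) = id
  ~-sym (inj₂ _) (inj₁ _) = id
  ~-sym (inj₂ _) (inj₂ _) = Adj-sym

  ~-irrefl : ∀ x y → x ≡ y → ¬ (x ~ y)
  ~-irrefl (inj₁ _) _ refl i≢i = i≢i refl
  ~-irrefl (inj₂ _) _ refl uu  = Adj-irrefl refl uu

  _~?_ : ∀ x y → Dec (x ~ y)
  inj₁ i ~? inj₁ j = ¬? (i Fin.≟ j)
  inj₁ i ~? inj₂ u = Fin.any? λ j → ¬? (j Fin.≟ i) ×-dec core j Fin.≟ u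
  inj₂ u ~? inj₁ i = Fin.any? λ j → ¬? (j Fin.≟ i) ×-dec core j Fin.≟ u
  inj₂ u ~? inj₂ w = adj? u w

  extended : Graph (3 + n)
  extended = record
    { Adj    = λ x y → Fin.splitAt 3 x ~ Fin.splitAt 3 y
    ; sym    = λ {x} {y} → ~-sym (Fin.splitAt 3 x) (Fin.splitAt 3 y)
    ; irrefl = λ {x} {y} x≡y → ~-irrefl (Fin.splitAt 3 x) (Fin.splitAt 3 y) (cong (Fin.splitAt 3) x≡y)
    ; adj?   = λ x y → Fin.splitAt 3 x ~? Fin.splitAt 3 y
    }

  core≢ : ∀ {i j} → i ≢ j → core i ≢ core j
  core≢ i≢j = i≢j ∘ core-injective

  -- Independence of the core. Together with `outer≁new` it makes every old neighbour of a core
  -- vertex a witness that misses all new vertices.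
  outer : ∀ {u i} → Adj u (core i) → Outer u
  outer {i = i} ui j refl = independent j i ui

  outer≁new : ∀ {u i} → Outer u → ¬ (inj₂ u ~ inj₁ i)
  outer≁new o (j , _ , eq) = o j eq

  core≁new : ∀ {i} → ¬ (inj₂ (core i) ~ inj₁ i)
  core≁new (j , j≢i , eq) = j≢i (core-injective eq)

  common : ∀ {x y} → x ≢ y → ∃[ z ] Adj z x × Adj z y
  common x≢y = proj₁ (pairwise _ _ x≢y)

  inj₂-≢ : ∀ {u w} → u ≢ w → _≢_ {A = Fin 3 ⊎ Fin n} (inj₂ u) (inj₂ w)
  inj₂-≢ u≢w refl = u≢w refl

  old-old : ∀ {u w} → u ≢ w → Resolved _~_ (inj₂ u) (inj₂ w)
  old-old u≢w with pairwise _ _ u≢w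
  ... | (z₁ , p₁) , (z₂ , z≢w₂ , p₂) , (z₃ , z≢u₃ , z≢w₃ , p₃) =
    (inj₂ z₁ , p₁) , (inj₂ z₂ , inj₂-≢ z≢w₂ , p₂) , (inj₂ z₃ , inj₂-≢ z≢u₃ , inj₂-≢ z≢w₃ , p₃)

  new-new : ∀ {i j} → i ≢ j → Resolved _~_ (inj₁ i) (inj₁ j)
  new-new {i} {j} i≢j =
    let k , k≢i , k≢j = avoid i j
        z , zi , _    = common (core≢ i≢j)
    in (inj₂ (core k) , (k , k≢i , refl) , (k , k≢j , refl))
     , (inj₂ (core j) , (λ ()) , (j , ≢-sym i≢j , refl) , core≁new)
     , (inj₂ z , (λ ()) , (λ ()) , outer≁new (outer zi) , outer≁new (outer zi))

  new-missed : ∀ i → Resolved _~_ (inj₁ i) (inj₂ (core i)) × Resolved _~_ (inj₂ (core i)) (inj₁ i)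
  new-missed i =
    let k , k≢i , _ = avoid i i
        z , zi , _  = common (core≢ (≢-sym k≢i))
        w , w≢i , wk , ¬wi = proj₁ (proj₂ (pairwise (core k) (core i) (core≢ k≢i)))
    in resolved-both _~_
         (inj₁ k , k≢i , (i , ≢-sym k≢i , refl))
         (inj₂ (core k) , inj₂-≢ (core≢ k≢i) , (k , k≢i , refl) , independent k i)
         (inj₂ z , (λ ()) , zi , outer≁new (outer zi))
         (inj₂ w , (λ ()) , inj₂-≢ w≢i , outer≁new (outer wk) , ¬wi)

  new-core : ∀ {i k} → k ≢ i → Resolved _~_ (inj₁ i) (inj₂ (core k)) × Resolved _~_ (inj₂ (core k)) (inj₁ i)
  new-core {i} {k} k≢i =
    let j , j≢i , j≢k = avoid i k
        z , zk , _    = common (core≢ k≢i)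
    in resolved-both _~_
         (inj₁ j , j≢i , (k , ≢-sym j≢k , refl))
         (inj₁ k , (λ ()) , k≢i , core≁new)
         (inj₂ z , (λ ()) , zk , outer≁new (outer zk))
         (inj₂ (core i) , (λ ()) , inj₂-≢ (core≢ (≢-sym k≢i)) , core≁new , independent i k)

  -- At most one core vertex is missed by `u` and exactly one by the new vertex, so the third index
  -- `j` gives a common neighbour. The other witnesses come from the old graph, applied to `u` and
  -- `core m`, and from the triangle.
  new-outer : ∀ i {u} → Outer u → Resolved _~_ (inj₁ i) (inj₂ u) × Resolved _~_ (inj₂ u) (inj₁ i)
  new-outer i {u} o =
    let m , u~   = attached u o
        j , j≢i , j≢m  = avoid i m
        z , zu , zm    = common (≢-sym (o m))
        w , w≢u , w≢m , ¬wu , _ = proj₂ (proj₂ (pairwise u (core m) (≢-sym (o m))))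
    in resolved-both _~_
         (inj₂ (core j) , (j , j≢i , refl) , Adj-sym (u~ j j≢m))
         (inj₁ j , (λ ()) , j≢i , λ (l , _ , eq) → o l eq)
         (inj₂ z , (λ ()) , zu , outer≁new (outer zm))
         -- Such a `w` is not in the core: it differs from `core m`, and the other core vertices are
         -- adjacent to `u`.
         (inj₂ w , (λ ()) , inj₂-≢ w≢u
           , (λ (l , _ , l≡w) → ¬wu (Adj-sym (subst (Adj u) l≡w (u~ l λ l≡m → w≢m (trans (sym l≡w) (cong core l≡m)))))) , ¬wu)

  new-old : ∀ i u → Resolved _~_ (inj₁ i) (inj₂ u) × Resolved _~_ (inj₂ u) (inj₁ i)
  new-old i u with Fin.any? (λ j → core j Fin.≟ u)
  ... | no  o = new-outer i λ j eq → o (j , eq)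
  ... | yes (k , refl) with k Fin.≟ i
  ...   | yes refl = new-missed i
  ...   | no  k≢i  = new-core k≢i

  resolved : ∀ x y → x ≢ y → Resolved _~_ x y
  resolved (inj₁ i) (inj₁ j) x≢y = new-new (x≢y ∘ cong inj₁)
  resolved (inj₁ i) (inj₂ u) x≢y = proj₁ (new-old i u)
  resolved (inj₂ u) (inj₁ i) x≢y = proj₂ (new-old i u)
  resolved (inj₂ u) (inj₂ w) x≢y = old-old (x≢y ∘ cong inj₂)

  extended-pairwise : PairwiseClosed extended
  extended-pairwise x y x≢y = resolved-via _~_ (Fin.splitAt 3) (Fin.join 3 n) (Fin.splitAt-join 3 n)
    (resolved (Fin.splitAt 3 x) (Fin.splitAt 3 y) λ eq →
      x≢y (trans (sym (Fin.join-splitAt 3 n x)) (trans (cong (Fin.join 3 n) eq) (Fin.join-splitAt 3 n y))))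

  attached-extended : ∀ x → (∀ j → inj₂ (core j) ≢ x) → ∃[ m ] ∀ j → j ≢ m → x ~ inj₂ (core j)
  attached-extended (inj₁ i) _ = i , λ j j≢i → j , j≢i , refl
  attached-extended (inj₂ u) o = attached u λ j eq → o j (cong inj₂ eq)

  pairs : List (Fin 3 × Fin 3)
  pairs = cartesianProduct (allFin 3) (allFin 3)

  increasing? : Decidable (λ ((i , j) : Fin 3 × Fin 3) → i Fin.< j)
  increasing? (i , j) = i Fin.<? j

  distinct? : Decidable (λ ((i , j) : Fin 3 × Fin 3) → j ≢ i)
  distinct? (i , j) = ¬? (j Fin.≟ i)

  side spoke : Fin 3 × Fin 3 → Fin (3 + n) × Fin (3 + n)
  side  (i , j) = i Fin.↑ˡ n , j Fin.↑ˡ n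
  spoke (i , j) = i Fin.↑ˡ n , 3 Fin.↑ʳ core j

  lift : Fin n × Fin n → Fin (3 + n) × Fin (3 + n)
  lift (u , w) = 3 Fin.↑ʳ u , 3 Fin.↑ʳ w

  sides spokes extended-edges : List (Fin (3 + n) × Fin (3 + n))
  sides  = map side (filter increasing? pairs)
  spokes = map spoke (filter distinct? pairs)
  extended-edges = sides ++ spokes ++ map lift (edges graph)

  ∈-extended-edges : ∀ x y → Fin.join 3 n x Fin.< Fin.join 3 n y → x ~ y → (Fin.join 3 n x , Fin.join 3 n y) ∈ extended-edges
  ∈-extended-edges (inj₁ i) (inj₁ j) lt _ =
    ∈-++⁺ˡ (∈-map⁺ side (∈-filter⁺ increasing? (∈-cartesianProduct⁺ (∈-allFin i) (∈-allFin j)) i<j))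
    where
    i<j : i Fin.< j
    i<j = subst id (cong₂ _<_ (Fin.toℕ-↑ˡ i n) (Fin.toℕ-↑ˡ j n)) lt
  ∈-extended-edges (inj₁ i) (inj₂ _) _ (j , j≢i , refl) =
    ∈-++⁺ʳ sides (∈-++⁺ˡ (∈-map⁺ spoke (∈-filter⁺ distinct? (∈-cartesianProduct⁺ (∈-allFin i) (∈-allFin j)) j≢i)))
  -- New vertices have the three smallest indices, so an increasing pair never leads from old to
  -- new.
  ∈-extended-edges (inj₂ u) (inj₁ i) lt _ =
    contradiction (subst (3 + toℕ u <_) (Fin.toℕ-↑ˡ i n) lt) (≤⇒≯ (≤-trans (<⇒≤ (Fin.toℕ<n i)) (m≤m+n 3 (toℕ u))))
  ∈-extended-edges (inj₂ u) (inj₂ w) lt uw =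
    ∈-++⁺ʳ sides (∈-++⁺ʳ spokes (∈-map⁺ lift (∈-edges⁺ graph (+-cancelˡ-< 3 _ _ lt) uw)))

  edges⊆ : edges extended ⊆ extended-edges
  edges⊆ {x , y} xy∈ =
    let x<y , xy = ∈-edges⁻ extended xy∈
    in subst (_∈ extended-edges) (cong₂ _,_ (Fin.join-splitAt 3 n x) (Fin.join-splitAt 3 n y))
         (∈-extended-edges (Fin.splitAt 3 x) (Fin.splitAt 3 y)
           (subst id (sym (cong₂ Fin._<_ (Fin.join-splitAt 3 n x) (Fin.join-splitAt 3 n y))) x<y) xy)

  ∣E-extended∣ : ∣E extended ∣ ≤ 9 + ∣E graph ∣
  ∣E-extended∣ = begin
    ∣E extended ∣                                  ≤⟨ length-⊆ (edges-unique extended) edges⊆ ⟩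
    -- The 3 sides and 6 spokes are counted by evaluation.
    9 + length (map lift (edges graph))            ≡⟨ cong (9 +_) (length-map lift (edges graph)) ⟩
    9 + ∣E graph ∣                                 ∎
    where open ≤-Reasoning

  extension : Anchored (3 + n)
  extension = record
    { graph          = extended
    ; core           = λ i → 3 Fin.↑ʳ core i
    ; core-injective = λ eq → core-injective (Fin.↑ʳ-injective 3 _ _ eq)
    -- `splitAt 3` computes on the shifted vertices, so adjacency of old vertices is definitionally
    -- the old one.
    ; independent    = independent
    ; attached       = λ x o → attached-extended (Fin.splitAt 3 x) λ j eq →
                         o j (trans (cong (Fin.join 3 n) eq) (Fin.join-splitAt 3 n x))
    ; pairwise       = extended-pairwise
    ; ∣E∣≤3n         = ≤-trans ∣E-extended∣ (≤-trans (+-monoʳ-≤ 9 ∣E∣≤3n) (≤-reflexive (sym (*-distribˡ-+ 3 3 n))))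
    }

-- The i-th vertex of the cycle is joined to the core vertices other than the i-th letter of the word.
module Cycle {k} (word : Vec (Fin 3) k) where

  -- Each edge in one direction; `symmetrised` adds the other. The last alternative between cycle
  -- vertices closes the cycle.
  _↝_ : Fin 3 ⊎ Fin k → Fin 3 ⊎ Fin k → Set
  inj₁ c ↝ inj₂ i = c ≢ lookup word i
  inj₂ i ↝ inj₂ j = toℕ j ≡ suc (toℕ i) ⊎ (toℕ j ≡ 0 × suc (toℕ i) ≡ k)
  _      ↝ inj₁ _ = ⊥

  _↝?_ : ∀ x y → Dec (x ↝ y)
  inj₁ c ↝? inj₂ i = ¬? (c Fin.≟ lookup word i)
  inj₂ i ↝? inj₂ j = (toℕ j ≟ suc (toℕ i)) ⊎-dec ((toℕ j ≟ 0) ×-dec (suc (toℕ i) ≟ k))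
  inj₁ _ ↝? inj₁ _ = no λ ()
  inj₂ _ ↝? inj₁ _ = no λ ()

  cycle : Graph (3 + k)
  cycle = symmetrised {R = λ x y → Fin.splitAt 3 x ↝ Fin.splitAt 3 y} (λ x y → Fin.splitAt 3 x ↝? Fin.splitAt 3 y)
  open Graph cycle using (Adj; adj?)

  core : Fin 3 → Fin (3 + k)
  core = Fin._↑ˡ k

  independent? : Dec (∀ i j → ¬ Adj (core i) (core j))
  independent? = Fin.all? λ i → Fin.all? λ j → ¬? (adj? (core i) (core j))

  attached? : Dec (∀ u → (∀ j → core j ≢ u) → ∃[ m ] ∀ j → j ≢ m → Adj u (core j))
  attached? = Fin.all? λ u → (Fin.all? λ j → ¬? (core j Fin.≟ u)) →-dec
    (Fin.any? λ m → Fin.all? λ j → ¬? (j Fin.≟ m) →-dec adj? u (core j))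

  -- For a concrete word the implicit arguments are solved by running the decision procedures.
  anchored : {_ : True independent?} {_ : True attached?} {_ : True (pairwise? cycle)} {_ : True (∣E cycle ∣ ≤? 3 * (3 + k))} →
             Anchored (3 + k)
  anchored {ind} {att} {pw} {few} = record
    { graph          = cycle
    ; core           = core
    ; core-injective = λ {i} {j} → Fin.↑ˡ-injective k i j
    ; independent    = toWitness {a? = independent?} ind
    ; attached       = toWitness {a? = attached?} att
    ; pairwise       = toWitness {a? = pairwise? cycle} pw
    ; ∣E∣≤3n         = toWitness {a? = ∣E cycle ∣ ≤? 3 * (3 + k)} few
    }

-- One base graph for each residue modulo 3, since an extension adds three vertices.
anchored : ∀ k → Anchored (9 + k)
anchored 0 = Cycle.anchored (0F ∷ 1F ∷ 2F ∷ 0F ∷ 1F ∷ 2F ∷ [])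
anchored 1 = Cycle.anchored (0F ∷ 1F ∷ 2F ∷ 0F ∷ 1F ∷ 2F ∷ 0F ∷ [])
-- With the word 01201201, the last vertex of the cycle and core vertex 0 would have no common neighbour.
anchored 2 = Cycle.anchored (0F ∷ 1F ∷ 2F ∷ 0F ∷ 0F ∷ 1F ∷ 2F ∷ 0F ∷ [])
anchored (suc (suc (suc k))) = Extension.extension (anchored k)

another : ∀ {n} (x : Fin (2 + n)) → ∃[ y ] x ≢ y
another zero    = suc zero , λ ()
another (suc x) = zero , λ ()

theorem3 : ∀ (v : ℕ) → v ≥ 3201 →
    ∃[ m ] IsMinEdges v 2 m × 3 * v ∸ 5625 ≤ m × m ≤ 3 * v + 25
theorem3 v v≥3201 with m≤n⇒∃[o]m+o≡n (≤-trans (m≤m+n 9 3192) v≥3201)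
... | k , refl =
  let open Anchored (anchored k) using (graph; pairwise; ∣E∣≤3n)
      m , isMin@((H , H-closed , ∣E-H∣≡m) , minimal) = minEdges graph pairwise
      -- The lower bound is applied to a graph `H` attaining the minimum; 615 + 5010 is 5625.
      3v≤m+615 = subst (λ e → 3 * (9 + k) ≤ e + 615) ∣E-H∣≡m
        (LowerBound.lower-bound H (closed⇒pairwise H H-closed) another)
      3v≤5625+m = ≤-trans 3v≤m+615 (≤-trans (+-monoʳ-≤ m (m≤m+n 615 5010)) (≤-reflexive (+-comm m 5625)))
  in m , isMin
   , m≤n+o⇒m∸n≤o (3 * (9 + k)) 5625 3v≤5625+m
   , ≤-trans (minimal graph (pairwise⇒closed graph pairwise)) (≤-trans ∣E∣≤3n (m≤m+n (3 * (9 + k)) 25))
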